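{- Let $\mathcal{M}=\{M_i\}_{i\in\mathcal{I}}$ be a family of $n=|\mathcal{I}|\ge 1$ MDPs with state set $S$, let $T\subseteq S$ be a target set and let $\lambda\in[0,1]$ be a threshold. Assume that the subroutines used by the recursive procedure $\textsc{buildTree}$ (defined in the context) terminate and that $\textsc{CreateSplit}$ returns non-trivial subsets (i.e. called on an index set $\mathcal{J}$ it returns some $\mathcal{J}'$ with $\emptyset\neq\mathcal{J}'\subsetneq\mathcal{J}$). Then $\textsc{buildTree}(\mathcal{I})$ is sound and complete, i.e. it terminates and its output is a (satisficing) policy tree for $\mathcal{M}$ and the specification "the probability of reaching $T$ is $\geq\lambda$"; moreover, it needs at most $n$ splits (calls to $\textsc{CreateSplit}$).
   Context: MDPs and families. An MDP is a tuple $M=(S,s_0,Act,P)$ with a countable set $S$ of states, an initial state $s_0\in S$, a finite set $Act$ of actions, and a partial transition function $P: S\times Act\nrightarrow Distr(S)$, where $Distr(S)$ is the set of probability distributions on $S$. Write $Act(s)=\{\alpha: P(s,\alpha)\neq\bot\}$ (where $\bot$ means undefined), assumed nonempty for all $s$. A policy is a deterministic memoryless map $\sigma:S\to Act$ with $\sigma(s)\in Act(s)$; $\Sigma^M$ is the set of policies of $M$; $M^\sigma$ is the induced Markov chain with transitions $P(s,\sigma(s))$. $\mathbb{P}[M^\sigma\models\Diamond T]$ is the probability of reaching $T$ from $s_0$ in $M^\sigma$, and $\mathbb{P}_{\max}[M\models\Diamond T]=\sup_{\sigma\in\Sigma^M}\mathbb{P}[M^\sigma\models\Diamond T]$. A policy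 $\sigma$ is winning for $M$ iff $\mathbb{P}[M^\sigma\models\Diamond T]\geq\lambda$. A family of MDPs is an indexed set $\mathcal{M}=\{M_i=(S,s_0,Act,P_i)\}_{i\in\mathcal{I}}$ with $\mathcal{I}$ finite such that for all $s,\alpha,i,j$, $P_i(s,\alpha)\neq\bot$ implies $P_j(s,\alpha)\neq\bot$; all members thus share the sets $Act(s)$ and the policy set, denoted $\Sigma^{\mathcal{M}}$. A policy $\sigma\in\Sigma^{\mathcal{M}}$ is robust for a (sub)family if it is winning for every MDP in it. Policy tree. A (satisficing) policy tree for $\mathcal{M}$ is $\mathcal{T}=(V,l,r,F,L)$ where $(V,l,r)$ is a binary tree with vertex set $V$ and partial functions $l,r:V\nrightarrow V$ giving the left and right successors of inner nodes, $F:V\to 2^{\mathcal{I}}$ associates nodes with subfamilies, and $L:V\nrightarrow\Sigma^{\mathcal{M}}\cup\{\varnothing\}$ labels the leaves. The root $R$ has $F(R)=\mathcal{I}$, and every node $v\in V$ is one of: (1) an inner node such that $F(l(v))$ and $F(r(v))$ form a disjoint partition of $F(v)$; (2) a leaf with $L(v)\in\Sigma^{\mathcal{M}}$ a robust policy for $\{M_i\}_{i\in F(v)}$; (3) a leaf with $L(v)=\varnothing$, where no $M_i$ with $i\in F(v)$ has a winning policy. Quotient MDP and game abstraction. For a family with index set $\mathcal{J}$, let $i\sim_{s,\alpha}j$ iff $P_i(s,\alpha)=P_j(s,\alpha)$, and let $\mathcal{J}/\!\sim_{s,\alpha}$ be the resulting partition of $\mathcal{J}$. The quotient MDP $\mathcal{Q}$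 has states $S$, initial state $s_0$, available actions $(\alpha,I)$ in $s$ for $\alpha\in Act(s)$, $I\in\mathcal{J}/\!\sim_{s,\alpha}$, and transitions $P_{\mathcal{Q}}(s,(\alpha,I))=P_i(s,\alpha)$ for any $i\in I$. The game abstraction $\mathcal{G}$ is the two-player turn-based stochastic game with Player 1 states $S$ (initial state $s_0$) and Player 2 states $(s,\alpha)$ with $s\in S$, $\alpha\in Act(s)$; in $s$, Player 1 chooses $\alpha\in Act(s)$ and the game moves to $(s,\alpha)$ with probability 1; in $(s,\alpha)$, Player 2 chooses $I\in\mathcal{J}/\!\sim_{s,\alpha}$ and the next state is drawn from $P_i(s,\alpha)$ for any $i\in I$. Both players use deterministic memoryless policies $\sigma_1,\sigma_2$, and $\mathbb{P}_{\max}[\mathcal{G}\models\Diamond T]=\sup_{\sigma_1}\inf_{\sigma_2}\mathbb{P}[\mathcal{G}^{\sigma_1,\sigma_2}\models\Diamond T]$. A Player 1 policy of $\mathcal{G}$ is a policy in $\Sigma^{\mathcal{M}}$. The procedure $\textsc{buildTree}(\mathcal{J})$, for nonempty $\mathcal{J}\subseteq\mathcal{I}$: (a) Run $\textsc{findRobust}(\{M_i\}_{i\in\mathcal{J}})$: build the game abstraction $\mathcal{G}$ of $\{M_i\}_{i\in\mathcal{J}}$ and compute the value $\mathbb{P}_{\max}[\mathcal{G}\models\Diamond T]$ together with an optimal policy $\sigma_{\mathcal{G}}$, whose Player 1 part $\sigma_1$ attains the value (i.e. $\inf_{\sigma_2}\mathbb{P}[\mathcal{G}^{\sigma_1,\sigma_2}\models\Diamond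 T]=\mathbb{P}_{\max}[\mathcal{G}\models\Diamond T]$). If the value is $\geq\lambda$, return a leaf node with subfamily $\mathcal{J}$ labelled by the policy $\sigma_1$. (b) Otherwise run $\textsc{testUnsat}(\{M_i\}_{i\in\mathcal{J}})$: build the quotient MDP $\mathcal{Q}$ of $\{M_i\}_{i\in\mathcal{J}}$ and compute $\mathbb{P}_{\max}[\mathcal{Q}\models\Diamond T]$. If it is $<\lambda$, return a leaf node with subfamily $\mathcal{J}$ labelled $\varnothing$. (c) Otherwise let $\mathcal{J}'=\textsc{CreateSplit}(\mathcal{J},\sigma_{\mathcal{G}})\subseteq\mathcal{J}$ and return an inner node with subfamily $\mathcal{J}$ whose two successors are the roots of $\textsc{buildTree}(\mathcal{J}')$ and $\textsc{buildTree}(\mathcal{J}\setminus\mathcal{J}')$. The algorithm is the call $\textsc{buildTree}(\mathcal{I})$; subroutines are understood to compute exact values and optimal policies. -}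

module Defs where

open import Data.Bool using (Bool; true; false) renaming (T to IsTrue)
open import Data.Empty using (⊥)
open import Data.Fin using (Fin; zero; suc)
import Data.Fin.Properties as Fin
open import Data.Fin.Subset
  using (Subset; _∈_; _⊂_; _∩_; _∪_; _─_; ∣_∣; Nonempty; Empty; ⊤)
open import Data.Fin.Subset.Properties using (_∈?_; nonempty?)
open import Data.List using (List; []; _∷_; map; foldr)
open import Data.List.Properties using (map-∘)
open import Data.List.Relation.Unary.All using (All; []; _∷_; universal)
open import Data.List.Relation.Unary.AllPairs using ([]; _∷_)
open import Data.List.Relation.Unary.Unique.Propositional using (Unique)
import Data.List.Relation.Unary.Unique.Propositional.Properties as Unique
open import Data.Maybe using (Maybe; just; nothing; is-just; to-witness-T)
open import Data.Maybe.Relation.Binary.Pointwise using (Pointwise)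
open import Data.Nat as ℕ using (ℕ)
open import Data.Product using (∃; ∃₂; ∃-syntax; _×_; _,_; proj₁; proj₂)
open import Data.Product.Function.NonDependent.Propositional using (_×-↔_)
open import Data.Rational as ℚ using (ℚ; 0ℚ; 1ℚ)
import Data.Rational.Properties as ℚ
open import Data.Sum using (_⊎_; inj₁; inj₂; [_,_]′)
open import Data.Sum.Properties using (inj₁-injective)
import Data.Unit as Unit
open import Data.Vec using ([]; _∷_; tabulate)
open import Data.Vec.Properties using (≡-dec)
open import Data.Bool.Properties using (T?) renaming (_≟_ to _≟ᵇ_)
open import Function using (_∘_; const; _↔_; _↣_; mk↔ₛ′)
open import Function.Construct.Composition using (_↔-∘_)
open import Function.Construct.Symmetry using (↔-sym)
open import Level using (0ℓ)
open import Relation.Binary.PropositionalEquality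
  using (_≡_; _≢_; refl; sym; cong; subst)
open import Relation.Nullary using (Dec; yes; no; ¬_; does; contradiction)
open import Relation.Nullary.Decidable using (recompute; _×-dec_)
open import Relation.Unary using (Pred)

------------------------------------------------------------------------
-- Extended non-negative reals

-- An element x of [0,∞] is its set {q ∈ ℚ | q < x}: a rounded lower set of
-- rationals containing every negative one. Unlike for Cauchy or Dedekind
-- reals, all suprema and infima exist without classical axioms; classically
-- these sets are in order-preserving bijection with [0,∞].

record [0,∞] : Set₁ where
  field
    Below    : ℚ → Set
    negative : ∀ {q} → q ℚ.< 0ℚ → Below q
    lower    : ∀ {p q} → p ℚ.< q → Below q → Below p
    rounded  : ∀ {p} → Below p → ∃[ q ] p ℚ.< q × Below q

open [0,∞]

infix 4 _≤_ _<_ _≈_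

_≤_ : [0,∞] → [0,∞] → Set
x ≤ y = ∀ {q} → Below x q → Below y q

_<_ : [0,∞] → [0,∞] → Set
x < y = ¬ (y ≤ x)

_≈_ : [0,∞] → [0,∞] → Set
x ≈ y = x ≤ y × y ≤ x

private
  shift : ∀ {r m} → r ℚ.< m → r ℚ.- m ℚ.< 0ℚ
  shift {r} {m} r<m =
    subst (r ℚ.- m ℚ.<_) (ℚ.+-inverseʳ m) (ℚ.+-monoˡ-< (ℚ.- m) r<m)

  unshift : ∀ r m → m ℚ.+ (r ℚ.- m) ≡ r
  unshift r m rewrite ℚ.+-comm r (ℚ.- m) | sym (ℚ.+-assoc m (ℚ.- m) r)
    | ℚ.+-inverseʳ m = ℚ.+-identityˡ r

  -- any r < m is below m + q for some q < 0
  gap : ∀ {r m} → r ℚ.< m → ∃[ q ] q ℚ.< 0ℚ × r ℚ.< m ℚ.+ q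
  gap {r} {m} r<m with ℚ.<-dense (shift r<m)
  ... | q , r-m<q , q<0 = q , q<0 ,
    subst (ℚ._< m ℚ.+ q) (unshift r m) (ℚ.+-monoʳ-< m r-m<q)

0∞ : [0,∞]
0∞ = record
  { Below = ℚ._< 0ℚ ; negative = λ q<0 → q<0
  ; lower = ℚ.<-trans ; rounded = ℚ.<-dense }

-- 1 if A holds and 0 otherwise
𝟙 : Set → [0,∞]
𝟙 A = record
  { Below    = λ r → r ℚ.< 0ℚ ⊎ (A × r ℚ.< 1ℚ)
  ; negative = inj₁
  ; lower    = λ { p<q (inj₁ q<0)       → inj₁ (ℚ.<-trans p<q q<0)
                 ; p<q (inj₂ (a , q<1)) → inj₂ (a , ℚ.<-trans p<q q<1) }
  ; rounded  = λ { (inj₁ p<0) → let q , p<q , q<0 = ℚ.<-dense p<0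
                                in q , p<q , inj₁ q<0
                 ; (inj₂ (a , p<1)) → let q , p<q , q<1 = ℚ.<-dense p<1
                                      in q , p<q , inj₂ (a , q<1) } }

1∞ : [0,∞]
1∞ = record
  { Below    = ℚ._< 1ℚ
  ; negative = λ q<0 → ℚ.<-trans q<0 (ℚ.positive⁻¹ 1ℚ)
  ; lower    = ℚ.<-trans
  ; rounded  = ℚ.<-dense }

infixl 6 _+_
infixl 7 _*_

_+_ : [0,∞] → [0,∞] → [0,∞]
x + y = record
  { Below    = λ r → ∃₂ λ p q → Below x p × Below y q × r ℚ.< p ℚ.+ q
  ; negative = λ r<0 → let m , r<m , m<0 = ℚ.<-dense r<0
                           q , q<0 , r<m+q = gap r<m
                       in m , q , negative x m<0 , negative y q<0 , r<m+q
  ; lower    = λ { r<s (p , q , p<x , q<y , s<p+q) →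
                   p , q , p<x , q<y , ℚ.<-trans r<s s<p+q }
  ; rounded  = λ { (p , q , p<x , q<y , r<p+q) →
                   let s , r<s , s<p+q = ℚ.<-dense r<p+q
                   in s , r<s , p , q , p<x , q<y , s<p+q } }

_*_ : [0,∞] → [0,∞] → [0,∞]
x * y = record
  { Below    = λ r → r ℚ.< 0ℚ ⊎
      ∃₂ λ p q → 0ℚ ℚ.≤ p × 0ℚ ℚ.≤ q × Below x p × Below y q × r ℚ.< p ℚ.* q
  ; negative = inj₁
  ; lower    = λ { r<s (inj₁ s<0) → inj₁ (ℚ.<-trans r<s s<0)
                 ; r<s (inj₂ (p , q , 0≤p , 0≤q , p<x , q<y , s<pq)) →
                   inj₂ (p , q , 0≤p , 0≤q , p<x , q<y , ℚ.<-trans r<s s<pq) }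
  ; rounded  = λ { (inj₁ r<0) → let s , r<s , s<0 = ℚ.<-dense r<0
                                in s , r<s , inj₁ s<0
                 ; (inj₂ (p , q , 0≤p , 0≤q , p<x , q<y , r<pq)) →
                   let s , r<s , s<pq = ℚ.<-dense r<pq
                   in s , r<s , inj₂ (p , q , 0≤p , 0≤q , p<x , q<y , s<pq) } }

-- The supremum of the empty family is 0.
⨆ : {A : Set} → (A → [0,∞]) → [0,∞]
⨆ {A} f = record
  { Below    = λ r → r ℚ.< 0ℚ ⊎ ∃[ a ] Below (f a) r
  ; negative = inj₁
  ; lower    = λ { p<q (inj₁ q<0)       → inj₁ (ℚ.<-trans p<q q<0)
                 ; p<q (inj₂ (a , q<x)) → inj₂ (a , lower (f a) p<q q<x) }
  ; rounded  = λ { (inj₁ p<0) → let q , p<q , q<0 = ℚ.<-dense p<0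
                                in q , p<q , inj₁ q<0
                 ; (inj₂ (a , p<x)) → let q , p<q , q<x = rounded (f a) p<x
                                      in q , p<q , inj₂ (a , q<x) } }

-- The intersection of lower sets need not be rounded, hence the r′ > r.
⨅ : {A : Set} → (A → [0,∞]) → [0,∞]
⨅ {A} f = record
  { Below    = λ r → ∃[ r′ ] r ℚ.< r′ × (∀ a → Below (f a) r′)
  ; negative = λ r<0 → let q , r<q , q<0 = ℚ.<-dense r<0
                       in q , r<q , λ a → negative (f a) q<0
  ; lower    = λ { p<q (r , q<r , r<f) → r , ℚ.<-trans p<q q<r , r<f }
  ; rounded  = λ { (r , p<r , r<f) → let q , p<q , q<r = ℚ.<-dense p<r
                                     in q , p<q , r , q<r , r<f } }

sum : List [0,∞] → [0,∞]
sum = foldr _+_ 0∞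

-- The sum of f over the subset P of A: the supremum of its finite subsums.
∑ : {A : Set} → Pred A 0ℓ → (A → [0,∞]) → [0,∞]
∑ {A} P f =
  ⨆ {∃ λ (xs : List A) → Unique xs × All P xs} (λ (xs , _) → sum (map f xs))

------------------------------------------------------------------------
-- Probability distributions

record Distr (S : Set) : Set₁ where
  field
    mass  : S → [0,∞]
    total : ∑ (const Unit.⊤) mass ≈ 1∞

open Distr

infix 4 _≈ᵈ_

_≈ᵈ_ : {S : Set} → Distr S → Distr S → Set
μ ≈ᵈ ν = ∀ s → mass μ s ≈ mass ν s

private
  x≤x+0 : ∀ x → x ≤ x + 0∞
  x≤x+0 x r<x = let m , r<m , m<x = rounded x r<x
                    q , q<0 , r<m+q = gap r<m
                in m , q , m<x , q<0 , r<m+q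

  drop-negˡ : ∀ x {p q r} → p ℚ.< 0ℚ → Below x q → r ℚ.< p ℚ.+ q → Below x r
  drop-negˡ x {p} {q} p<0 q<x r<p+q = lower x
    (ℚ.<-trans r<p+q (subst (p ℚ.+ q ℚ.<_) (ℚ.+-identityˡ q) (ℚ.+-monoˡ-< q p<0)))
    q<x

  drop-negʳ : ∀ x {p q r} → q ℚ.< 0ℚ → Below x p → r ℚ.< p ℚ.+ q → Below x r
  drop-negʳ x {p} {q} {r} q<0 p<x r<p+q =
    drop-negˡ x q<0 p<x (subst (r ℚ.<_) (ℚ.+-comm p q) r<p+q)

  module _ {A : Set} (a : A) where
    dirac-zero : ∀ {xs} → All (a ≢_) xs → sum (map (λ x → 𝟙 (a ≡ x)) xs) ≤ 0∞
    dirac-zero [] r<0 = r<0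
    dirac-zero (a≢x ∷ _) (p , q , inj₂ (a≡x , _) , _) = contradiction a≡x a≢x
    dirac-zero (_ ∷ a∉xs) (p , q , inj₁ p<0 , q<xs , r<p+q) =
      drop-negˡ 0∞ p<0 (dirac-zero a∉xs q<xs) r<p+q

    dirac-one : ∀ {xs} → Unique xs → sum (map (λ x → 𝟙 (a ≡ x)) xs) ≤ 1∞
    dirac-one [] r<0 = negative 1∞ r<0
    dirac-one (_ ∷ u) (p , q , inj₁ p<0 , q<xs , r<p+q) =
      drop-negˡ 1∞ p<0 (dirac-one u q<xs) r<p+q
    dirac-one (x∉xs ∷ u) (p , q , inj₂ (refl , p<1) , q<xs , r<p+q) =
      drop-negʳ 1∞ (dirac-zero x∉xs q<xs) p<1 r<p+q

dirac : {S : Set} → S → Distr S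
dirac s = record
  { mass  = λ t → 𝟙 (s ≡ t)
  ; total = (λ { (inj₁ r<0) → negative 1∞ r<0
               ; (inj₂ ((_ , u , _) , r<xs)) → dirac-one s u r<xs })
          , (λ r<1 → inj₂ ((s ∷ [] , [] ∷ [] , Unit.tt ∷ [])
                          , x≤x+0 (𝟙 (s ≡ s)) (inj₂ (refl , r<1)))) }

private
  module _ {A B : Set} where
    lefts : List (A ⊎ B) → List A
    lefts []            = []
    lefts (inj₁ a ∷ xs) = a ∷ lefts xs
    lefts (inj₂ _ ∷ xs) = lefts xs

    lefts-∉ : ∀ {a} xs → All (inj₁ a ≢_) xs → All (a ≢_) (lefts xs)
    lefts-∉ []            []        = []
    lefts-∉ (inj₁ _ ∷ xs) (≢x ∷ ≢s) = (≢x ∘ cong inj₁) ∷ lefts-∉ xs ≢s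
    lefts-∉ (inj₂ _ ∷ xs) (_ ∷ ≢s)  = lefts-∉ xs ≢s

    lefts-unique : ∀ xs → Unique xs → Unique (lefts xs)
    lefts-unique []            []      = []
    lefts-unique (inj₁ _ ∷ xs) (x ∷ u) = lefts-∉ xs x ∷ lefts-unique xs u
    lefts-unique (inj₂ _ ∷ xs) (_ ∷ u) = lefts-unique xs u

    lefts-sum : ∀ (f : A → [0,∞]) xs →
      sum (map [ f , const 0∞ ]′ xs) ≤ sum (map f (lefts xs))
    lefts-sum f []            r<0 = r<0
    lefts-sum f (inj₁ _ ∷ xs) (p , q , p<x , q<xs , r<) =
      p , q , p<x , lefts-sum f xs q<xs , r<
    lefts-sum f (inj₂ _ ∷ xs) (p , q , p<0 , q<xs , r<) =
      drop-negˡ (sum (map f (lefts xs))) p<0 (lefts-sum f xs q<xs) r<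

-- a distribution on S, seen as one on S ⊎ V
embed : {S V : Set} → Distr S → Distr (S ⊎ V)
embed {S} {V} μ = record { mass = mass′ ; total = ≤1 , 1≤ }
  where
  mass′ : S ⊎ V → [0,∞]
  mass′ = [ mass μ , const 0∞ ]′

  ≤1 : ∑ (const Unit.⊤) mass′ ≤ 1∞
  ≤1 (inj₁ r<0)                  = negative 1∞ r<0
  ≤1 (inj₂ ((xs , u , _) , r<xs)) = proj₁ (total μ)
    (inj₂ ((lefts xs , lefts-unique xs u , universal _ (lefts xs))
          , lefts-sum (mass μ) xs r<xs))

  1≤ : 1∞ ≤ ∑ (const Unit.⊤) mass′
  1≤ {r} r<1 with proj₂ (total μ) r<1
  ... | inj₁ r<0                   = inj₁ r<0
  ... | inj₂ ((xs , u , _) , r<xs) = inj₂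
    ((map inj₁ xs , Unique.map⁺ inj₁-injective u , universal _ (map inj₁ xs))
    , subst (λ ys → Below (sum ys) r) (map-∘ xs) r<xs)

------------------------------------------------------------------------
-- Markov chains and reachability probabilities

record MarkovChain (S : Set) : Set₁ where
  field
    s₀   : S
    step : S → Distr S

module _ {S : Set} (C : MarkovChain S) (T : Pred S 0ℓ) where
  open MarkovChain C

  -- A finite path is given by its first state and the list of later ones;
  -- pathMass is the probability of its cylinder set.
  pathMass : S → List S → [0,∞]
  pathMass s []      = 1∞
  pathMass s (t ∷ π) = mass (step s) t * pathMass t π

  FirstHit : S → List S → Set
  FirstHit s []      = T s
  FirstHit s (t ∷ π) = ¬ T s × FirstHit t π

  -- The event ◇T is the disjoint union of the cylinder sets of the finite
  -- paths from s₀ that visit T at their last state and not before.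
  ℙ◇ : [0,∞]
  ℙ◇ = ∑ (FirstHit s₀) (pathMass s₀)

------------------------------------------------------------------------
-- MDPs and stochastic games

record Policy {X A : Set} (Available : X → A → Set) : Set where
  field
    choice    : X → A
    available : ∀ x → Available x (choice x)

open Policy

-- Is-just would live in Set₁ here.
Defined : {A : Set₁} → Maybe A → Set
Defined m = IsTrue (is-just m)

record MDP (S Act : Set) : Set₁ where
  field
    countable : S ↣ ℕ
    finite    : ∃[ m ] Act ↔ Fin m
    s₀        : S
    P         : S → Act → Maybe (Distr S)

  Available : S → Act → Set
  Available s α = Defined (P s α)

  field
    nonblocking : ∀ s → ∃[ α ] Available s α

  induced : Policy Available → MarkovChain S
  induced σ = record { s₀ = s₀ ; step = λ s → to-witness-T (P s (choice σ s)) (available σ s) }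

  ℙmax : Pred S 0ℓ → [0,∞]
  ℙmax T = ⨆ λ (σ : Policy Available) → ℙ◇ (induced σ) T

record Game (V₁ V₂ A₁ A₂ : Set) : Set₁ where
  field
    v₀         : V₁
    Available₁ : V₁ → A₁ → Set
    Available₂ : V₂ → A₂ → Set
    P₁         : ∀ v a → Available₁ v a → Distr (V₁ ⊎ V₂)
    P₂         : ∀ v a → Available₂ v a → Distr (V₁ ⊎ V₂)

  induced : Policy Available₁ → Policy Available₂ → MarkovChain (V₁ ⊎ V₂)
  induced σ₁ σ₂ = record
    { s₀   = inj₁ v₀
    ; step = λ { (inj₁ v) → P₁ v (choice σ₁ v) (available σ₁ v)
               ; (inj₂ v) → P₂ v (choice σ₂ v) (available σ₂ v) } }

  module _ (T : Pred V₁ 0ℓ) where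
    guaranteed : Policy Available₁ → [0,∞]
    guaranteed σ₁ = ⨅ λ (σ₂ : Policy Available₂) →
      ℙ◇ (induced σ₁ σ₂) [ T , const ⊥ ]′

    ℙmax : [0,∞]
    ℙmax = ⨆ guaranteed

------------------------------------------------------------------------
-- Families of MDPs

record Family (n : ℕ) : Set₁ where
  field
    S Act       : Set
    countable   : S ↣ ℕ
    finite      : ∃[ m ] Act ↔ Fin m
    s₀          : S
    P           : Fin n → S → Act → Maybe (Distr S)
    shared      : ∀ s α i j → Defined (P i s α) → Defined (P j s α)
    nonblocking : ∀ i s → ∃[ α ] Defined (P i s α)

  member : Fin n → MDP S Act
  member i = record
    { countable = countable ; finite = finite ; s₀ = s₀
    ; P = P i ; nonblocking = nonblocking i }

  -- By shared (and for n ≥ 1) these are the actions available in any member.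
  Available : S → Act → Set
  Available s α = ∀ i → Defined (P i s α)

  restrict : Policy Available → ∀ i → Policy (MDP.Available (member i))
  restrict σ i = record
    { choice = choice σ ; available = λ s → available σ s i }

  _∼[_,_]_ : Fin n → S → Act → Fin n → Set₁
  i ∼[ s , α ] j = Pointwise _≈ᵈ_ (P i s α) (P j s α)

module _ {n : ℕ} (M : Family n) where
  open Family M

  module _ (T : Pred S 0ℓ) (threshold : [0,∞]) where

    Winning : ∀ i → Policy (MDP.Available (member i)) → Set
    Winning i σ = threshold ≤ ℙ◇ (MDP.induced (member i) σ) T

    Robust : Subset n → Policy Available → Set
    Robust J σ = ∀ i → i ∈ J → Winning i (restrict σ i)

------------------------------------------------------------------------
-- Policy trees

-- The label nothing stands for ∅.
data Tree (n : ℕ) (Label : Set) : Set where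
  leaf : Subset n → Maybe Label → Tree n Label
  node : Subset n → Tree n Label → Tree n Label → Tree n Label

subfamily : ∀ {n Label} → Tree n Label → Subset n
subfamily (leaf J _)   = J
subfamily (node J _ _) = J

record Partition {n} (J K L : Subset n) : Set where
  field
    nonemptyˡ : Nonempty K
    nonemptyʳ : Nonempty L
    disjoint  : Empty (K ∩ L)
    covers    : K ∪ L ≡ J

module _ {n : ℕ} (M : Family n)
         (T : Pred (Family.S M) 0ℓ) (threshold : [0,∞]) where
  open Family M

  data Satisficing : Tree n (Policy Available) → Set where
    inner : ∀ {J l r} → Partition J (subfamily l) (subfamily r) →
            Satisficing l → Satisficing r → Satisficing (node J l r)
    robust : ∀ {J σ} → Robust M T threshold J σ → Satisficing (leaf J (just σ))
    unsat : ∀ {J} → (∀ i → i ∈ J → ¬ ∃ (Winning M T threshold i)) →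
            Satisficing (leaf J nothing)

  IsPolicyTree : Tree n (Policy Available) → Set
  IsPolicyTree t = subfamily t ≡ ⊤ × Satisficing t

------------------------------------------------------------------------
-- Quotient MDP and game abstraction

-- Forming J/∼ as a set of subsets of J takes a decision procedure for ∼,
-- which classically always exists.
DecidableClasses : ∀ {n} → Family n → Set₁
DecidableClasses M = ∀ s α i j → Dec (i ∼[ s , α ] j)
  where open Family M

private
  Subset↔Fin : ∀ n → Subset n ↔ Fin (2 ℕ.^ n)
  Subset↔Fin ℕ.zero = mk↔ₛ′ (λ _ → zero) (λ _ → [])
    (λ { zero → refl ; (suc ()) }) (λ { [] → refl })
  Subset↔Fin (ℕ.suc n) =
    ↔-sym Fin.*↔× ↔-∘ ((↔-sym Fin.2↔Bool ×-↔ Subset↔Fin n) ↔-∘ uncons)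
    where
    uncons : Subset (ℕ.suc n) ↔ (Bool × Subset n)
    uncons = mk↔ₛ′ (λ { (b ∷ J) → b , J }) (λ (b , J) → b ∷ J)
      (λ _ → refl) (λ { (_ ∷ _) → refl })

module Abstraction {n : ℕ} (M : Family n) (_∼?_ : DecidableClasses M)
                   (J : Subset n) where
  open Family M

  class : S → Act → Fin n → Subset n
  class s α i = tabulate λ j → does ((j ∈? J) ×-dec (s ∼? α) i j)

  -- I ∈ J/∼
  IsClass : S → Act → Subset n → Set
  IsClass s α I = ∃[ i ] i ∈ J × I ≡ class s α i

  isClass? : ∀ s α I → Dec (IsClass s α I)
  isClass? s α I = Fin.any? λ i → (i ∈? J) ×-dec ≡-dec _≟ᵇ_ I (class s α i)

  quotientP : S → Act × Subset n → Maybe (Distr S)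
  quotientP s (α , I) with isClass? s α I
  ... | yes (i , _) = P i s α
  ... | no _        = nothing

  private
    quotientP-just : ∀ {i} s α → i ∈ J → Available s α →
                     Defined (quotientP s (α , class s α i))
    quotientP-just {i} s α i∈J av with isClass? s α (class s α i)
    ... | yes (j , _) = av j
    ... | no ¬class   = contradiction (i , i∈J , refl) ¬class

  quotient : .(Nonempty J) → MDP S (Act × Subset n)
  quotient J≢∅ = record
    { countable   = countable
    ; finite      = _ , ↔-sym Fin.*↔× ↔-∘ (proj₂ finite ×-↔ Subset↔Fin n)
    ; s₀          = s₀
    ; P           = quotientP
    ; nonblocking = λ s →
        let i , i∈J = recompute (nonempty? J) J≢∅
            α , av  = nonblocking i s
        in (α , class s α i)
         , quotientP-just s α i∈J (λ j → shared s α i j av)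
    }

  -- The availability proof is irrelevant so that a state is determined by
  -- state and action; otherwise paths could be counted repeatedly.
  record State₂ : Set where
    constructor _,_
    field
      state        : S
      action       : Act
      .{available} : Available state action

  distr : ∀ i s α → .(Available s α) → Distr S
  distr i s α av = to-witness-T (P i s α) (recompute (T? _) (av i))

  game : Game S State₂ Act (Subset n)
  game = record
    { v₀         = s₀
    ; Available₁ = Available
    ; Available₂ = λ (s , α) I → IsClass s α I
    ; P₁         = λ s α av → dirac (inj₂ ((s , α) {av}))
    ; P₂         = λ { ((s , α) {av}) _ (i , _) → embed (distr i s α av) }
    }

------------------------------------------------------------------------
-- The procedure buildTree

module _ {n : ℕ} (M : Family n) (_∼?_ : DecidableClasses M)
         (T : Pred (Family.S M) 0ℓ) (threshold : [0,∞]) where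
  open Family M
  private
    module A = Abstraction M _∼?_
    module G (J : Subset n) = Game (A.game J)
    module Q (J : Subset n) .(ne : Nonempty J) = MDP (A.quotient J ne)

  record Subroutines : Set where
    field
      findRobust : ∀ J → .(Nonempty J) →
        Policy (G.Available₁ J) × Policy (G.Available₂ J)
      findRobust-optimal : ∀ J .(ne : Nonempty J) →
        G.guaranteed J T (proj₁ (findRobust J ne)) ≈ G.ℙmax J T
      robust? : ∀ J → .(Nonempty J) → Dec (threshold ≤ G.ℙmax J T)
      unsat?  : ∀ J → .(ne : Nonempty J) → Dec (Q.ℙmax J ne T < threshold)

      createSplit : ∀ J → .(Nonempty J) →
        Policy (G.Available₁ J) × Policy (G.Available₂ J) → Subset n
      -- A singleton has no non-trivial subset, so nothing is assumed there.
      createSplit-nontrivial : ∀ J .(ne : Nonempty J) → 2 ℕ.≤ ∣ J ∣ →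
        let J′ = createSplit J ne (findRobust J ne)
        in Nonempty J′ × J′ ⊂ J

  -- BuildTree J t k: the call buildTree(J) terminates with output t after k
  -- calls of createSplit. There is no rule for empty J.
  module _ (sub : Subroutines) where
    open Subroutines sub

    data BuildTree (J : Subset n) : Tree n (Policy Available) → ℕ → Set where
      robust : .(ne : Nonempty J) →
        threshold ≤ G.ℙmax J T →
        BuildTree J (leaf J (just (proj₁ (findRobust J ne)))) 0
      unsat : .(ne : Nonempty J) →
        ¬ (threshold ≤ G.ℙmax J T) →
        Q.ℙmax J ne T < threshold →
        BuildTree J (leaf J nothing) 0
      split : ∀ {l r k m} .(ne : Nonempty J) →
        ¬ (threshold ≤ G.ℙmax J T) →
        ¬ (Q.ℙmax J ne T < threshold) →
        let J′ = createSplit J ne (findRobust J ne) in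
        BuildTree J′ l k →
        BuildTree (J ─ J′) r m →
        BuildTree J (node J l r) (1 ℕ.+ k ℕ.+ m)

{-# OPTIONS --safe #-}
module Submission where

-- Player 2 may always pick the class of a fixed member, so the value that σ₁
-- guarantees in the game is a lower bound for σ₁ in every member; dually, a
-- policy of a member is one of the quotient, whose value is an upper bound.
-- If J is a singleton, the quotient value does not exceed the game value, so one
-- of the two leaf tests succeeds. Hence only sets with at least two elements
-- are split, and the tree over J has at most ∣ J ∣ − 1 inner nodes.
--
-- A path s t … of a member corresponds to the path s (s , σ₁ s) t … of the game;
-- all other game paths have probability 0.

open import Defs
open import Data.Bool using (true; false)
open import Data.Empty using (⊥)
open import Data.Fin using (zero)
import Data.Fin.Properties as Fin
open import Data.Fin.Subset
  using (Subset; inside; outside; _∈_; _⊆_; _⊂_; _∪_; _─_; ∣_∣; Nonempty; ⊤; ⁅_⁆)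
open import Data.Fin.Subset.Properties
  using (_∈?_; nonempty?; ∈⊤; ∣⊤∣≡n; ∣⁅x⁆∣≡1; x∈⁅y⁆⇒x≡y; p⊂q⇒∣p∣<∣q∣; drop-∷-⊆;
         ⊆-antisym; x∈p∩q⁺; x∈p∩q⁻; x∈p∪q⁺; x∈p∪q⁻; p─q⊆p;
         x∈p∧x∉q⇒x∈p─q; p∩q≢∅⇒∣p─q∣<∣p∣)
open import Data.List using (List; []; _∷_; map)
open import Data.List.Membership.Propositional using () renaming (_∈_ to _∈ˡ_)
open import Data.List.Properties using (∷-injective; ∷-injectiveʳ)
open import Data.List.Relation.Unary.All as All using (All; []; _∷_)
open import Data.List.Relation.Unary.AllPairs using ([]; _∷_)
open import Data.List.Relation.Unary.Any using (here; there)
open import Data.List.Relation.Unary.Unique.Propositional using (Unique)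
open import Data.Maybe using (Maybe; to-witness-T)
open import Data.Maybe.Relation.Binary.Pointwise as Pointwise
  using (Pointwise; just)
open import Data.Nat as ℕ using (ℕ)
open import Data.Nat.Induction using (Acc; acc; <-wellFounded)
import Data.Nat.Properties as ℕ
open import Data.Product using (∃₂; ∃-syntax; _×_; _,_; proj₁; proj₂; swap)
open import Data.Rational as ℚ using (ℚ; 0ℚ; 1ℚ)
import Data.Rational.Properties as ℚ
open import Data.Sum using (_⊎_; inj₁; inj₂; [_,_]′)
open import Data.Vec using ([]; _∷_; here; there)
open import Data.Vec.Properties using (lookup⇒[]=; []=⇒lookup; lookup∘tabulate)
open import Function using (const; _∘_)
open import Level using (0ℓ)
open import Relation.Binary.PropositionalEquality
  using (_≡_; _≢_; refl; sym; trans; cong; subst; subst₂)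
open import Relation.Nullary using (Dec; yes; no; ¬_; does; contradiction)
open import Relation.Nullary.Decidable using (recompute; dec-true; _×-dec_)
open import Relation.Unary using (Pred)

open [0,∞]
open Distr
open Policy

-- Arithmetic and sums in `[0,∞]`.

+-drop-negˡ : ∀ x {p q r} → p ℚ.< 0ℚ → Below x q → r ℚ.< p ℚ.+ q → Below x r
+-drop-negˡ x {p} {q} p<0 q<x r<p+q = lower x
  (ℚ.<-trans r<p+q (subst (p ℚ.+ q ℚ.<_) (ℚ.+-identityˡ q) (ℚ.+-monoˡ-< q p<0)))
  q<x

*-mono-≤ : ∀ {x x′ y y′} → x ≤ x′ → y ≤ y′ → x * y ≤ x′ * y′
*-mono-≤ x≤x′ y≤y′ (inj₁ r<0) = inj₁ r<0
*-mono-≤ x≤x′ y≤y′ (inj₂ (p , q , 0≤p , 0≤q , p<x , q<y , r<pq)) =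
  inj₂ (p , q , 0≤p , 0≤q , x≤x′ p<x , y≤y′ q<y , r<pq)

-- A non-negative rational gets below a product only through non-negative factors, and none lies
-- below `0∞`.
0∞*⁻ : ∀ y {r} → Below (0∞ * y) r → r ℚ.< 0ℚ
0∞*⁻ y (inj₁ r<0) = r<0
0∞*⁻ y (inj₂ (p , _ , 0≤p , _ , p<0 , _)) =
  contradiction (ℚ.≤-<-trans 0≤p p<0) (ℚ.<-irrefl refl)

-- Applied to a Dirac step of a path, this extracts the equation that fixes its target without
-- deciding `A`.
𝟙*⁻ : ∀ {A} x {r} → Below (𝟙 A * x) r → r ℚ.< 0ℚ ⊎ (A × Below x r)
𝟙*⁻ x (inj₁ r<0) = inj₁ r<0
𝟙*⁻ x (inj₂ (p , _ , 0≤p , _ , inj₁ p<0 , _)) =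
  contradiction (ℚ.≤-<-trans 0≤p p<0) (ℚ.<-irrefl refl)
𝟙*⁻ x {r} (inj₂ (p , q , 0≤p , 0≤q , inj₂ (a , p<1) , q<x , r<pq)) =
  inj₂ (a , lower x (ℚ.<-≤-trans r<pq pq≤q) q<x)
  where
  instance _ = ℚ.nonNegative 0≤q
  pq≤q : p ℚ.* q ℚ.≤ q
  pq≤q = subst (p ℚ.* q ℚ.≤_) (ℚ.*-identityˡ q)
    (ℚ.*-monoʳ-≤-nonNeg q (ℚ.<⇒≤ p<1))

-- `1ℚ` is not below `𝟙 A`, so multiplying by `𝟙 A` takes a factor strictly less than 1. The
-- quotient m/q works for any m strictly between r and q.
<⇒<fraction : ∀ {r q} → 0ℚ ℚ.≤ r → r ℚ.< q →
              ∃[ p ] 0ℚ ℚ.≤ p × p ℚ.< 1ℚ × r ℚ.< p ℚ.* q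
<⇒<fraction {r} {q} 0≤r r<q with ℚ.<-dense r<q
... | m , r<m , m<q = m ℚ.* 1/q , 0≤m/q , m/q<1 , subst (r ℚ.<_) (sym m/q*q≡m) r<m
  where
  instance
    q⁺ : ℚ.Positive q
    q⁺ = ℚ.positive (ℚ.≤-<-trans 0≤r r<q)
    q≢0 : ℚ.NonZero q
    q≢0 = ℚ.pos⇒nonZero q
  1/q : ℚ
  1/q = ℚ.1/ q
  instance
    1/q⁺ : ℚ.Positive 1/q
    1/q⁺ = ℚ.1/pos⇒pos q
    1/q⁰ : ℚ.NonNegative 1/q
    1/q⁰ = ℚ.nonNegative (ℚ.<⇒≤ (ℚ.positive⁻¹ 1/q))
  0≤m/q : 0ℚ ℚ.≤ m ℚ.* 1/q
  0≤m/q = subst (ℚ._≤ m ℚ.* 1/q) (ℚ.*-zeroˡ 1/q)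
    (ℚ.*-monoʳ-≤-nonNeg 1/q (ℚ.<⇒≤ (ℚ.≤-<-trans 0≤r r<m)))
  m/q<1 : m ℚ.* 1/q ℚ.< 1ℚ
  m/q<1 = subst (m ℚ.* 1/q ℚ.<_) (ℚ.*-inverseʳ q) (ℚ.*-monoˡ-<-pos 1/q m<q)
  m/q*q≡m : m ℚ.* 1/q ℚ.* q ≡ m
  m/q*q≡m = trans (ℚ.*-assoc m 1/q q)
    (trans (cong (m ℚ.*_) (ℚ.*-inverseˡ q)) (ℚ.*-identityʳ m))

𝟙*⁺ : ∀ {A} x → A → x ≤ 𝟙 A * x
𝟙*⁺ x a {r} r<x with r ℚ.<? 0ℚ
... | yes r<0 = inj₁ r<0
... | no r≮0 =
  let 0≤r = ℚ.≮⇒≥ r≮0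
      -- Moving up from r to q makes room for the loss caused by the factor p < 1.
      q , r<q , q<x = rounded x r<x
      p , 0≤p , p<1 , r<pq = <⇒<fraction 0≤r r<q
  in inj₂ (p , q , 0≤p , ℚ.<⇒≤ (ℚ.≤-<-trans 0≤r r<q) , inj₂ (a , p<1) , q<x , r<pq)

-- Every approximation of a term of the first sum has to reappear in the second,
-- so terms that contribute nothing may be dropped without deciding which.
module _ {A B : Set} {P : Pred A 0ℓ} {Q : Pred B 0ℓ} {f : A → [0,∞]} {g : B → [0,∞]}
  (R : A → B → Set) (R-injective : ∀ {a a′ b} → R a b → R a′ b → a ≡ a′)
  (transfer : ∀ {a r} → P a → Below (f a) r →
              r ℚ.< 0ℚ ⊎ ∃[ b ] Q b × R a b × Below (g b) r) where

  private
    -- Remembering where the entries of the new list come from is what lets `R-injective` rule out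
    -- repetitions in it.
    Source : List A → B → Set
    Source xs b = ∃[ a ] a ∈ˡ xs × R a b

    transfer-sum : ∀ {r} xs → Unique xs → All P xs → Below (sum (map f xs)) r →
      ∃[ ys ] Unique ys × All Q ys × All (Source xs) ys × Below (sum (map g ys)) r
    transfer-sum [] [] [] r<0 = [] , [] , [] , [] , r<0
    transfer-sum (x ∷ xs) (x∉xs ∷ u) (px ∷ pxs) (p , q , p<fx , q<fxs , r<p+q)
      with transfer-sum xs u pxs q<fxs | transfer px p<fx
    ... | ys , v , qys , ys←xs , q<gys | inj₁ p<0 =
      ys , v , qys
      , All.map (λ (a , a∈xs , Rab) → a , there a∈xs , Rab) ys←xs
      , +-drop-negˡ (sum (map g ys)) p<0 q<gys r<p+q
    ... | ys , v , qys , ys←xs , q<gys | inj₂ (b , qb , Rxb , p<gb) =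
      b ∷ ys
      , All.map (λ { (a , a∈xs , Ray) refl →
                     All.lookup x∉xs a∈xs (R-injective Rxb Ray) }) ys←xs ∷ v
      , qb ∷ qys
      , (x , here refl , Rxb)
        ∷ All.map (λ (a , a∈xs , Rab) → a , there a∈xs , Rab) ys←xs
      , p , q , p<gb , q<gys , r<p+q

  ∑-transfer : ∑ P f ≤ ∑ Q g
  ∑-transfer (inj₁ r<0) = inj₁ r<0
  ∑-transfer (inj₂ ((xs , u , pxs) , r<fxs)) =
    let ys , v , qys , _ , r<gys = transfer-sum xs u pxs r<fxs
    in inj₂ ((ys , v , qys) , r<gys)

-- Comparison of Markov chains and of partial distributions.

module _ {S : Set} (T : Pred S 0ℓ) {s₀ : S} {c d : S → Distr S}
         (c≤d : ∀ s t → mass (c s) t ≤ mass (d s) t) where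
  private
    C D : MarkovChain S
    C = record { s₀ = s₀ ; step = c }
    D = record { s₀ = s₀ ; step = d }

    pathMass-mono : ∀ s π → pathMass C T s π ≤ pathMass D T s π
    pathMass-mono s []      r<1 = r<1
    pathMass-mono s (t ∷ π) = *-mono-≤ {mass (c s) t} {mass (d s) t}
      {pathMass C T t π} {pathMass D T t π} (c≤d s t) (pathMass-mono t π)

    -- The condition concerns `T` and the path alone, but its instances at `C` and `D` coincide only
    -- once the path is split.
    FirstHit-step : ∀ s π → FirstHit C T s π → FirstHit D T s π
    FirstHit-step s []      hit         = hit
    FirstHit-step s (t ∷ π) (¬hit , hit) = ¬hit , FirstHit-step t π hit

  ℙ◇-mono : ℙ◇ C T ≤ ℙ◇ D T
  ℙ◇-mono = ∑-transfer _≡_ (λ { refl refl → refl }) λ {π} hit r<π →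
    inj₂ (π , FirstHit-step s₀ π hit , refl , pathMass-mono s₀ π r<π)

≈ᵈ-refl : {S : Set} {μ : Distr S} → μ ≈ᵈ μ
≈ᵈ-refl s = (λ r<μ → r<μ) , (λ r<μ → r<μ)

Pointwise-≈ᵈ-refl : {S : Set} {m : Maybe (Distr S)} → Pointwise _≈ᵈ_ m m
Pointwise-≈ᵈ-refl = Pointwise.refl λ {μ} → ≈ᵈ-refl {μ = μ}

Defined-resp : {S : Set} {m m′ : Maybe (Distr S)} →
  Pointwise _≈ᵈ_ m m′ → Defined m → Defined m′
Defined-resp (just _) d = d

to-witness-≈ᵈ : {S : Set} {m m′ : Maybe (Distr S)} → Pointwise _≈ᵈ_ m m′ →
  (d : Defined m) (d′ : Defined m′) → to-witness-T m d ≈ᵈ to-witness-T m′ d′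
to-witness-≈ᵈ (just μ≈ν) _ _ = μ≈ν

to-witness-cong : {S : Set} {m m′ : Maybe (Distr S)} → m ≡ m′ →
  (d : Defined m) (d′ : Defined m′) → to-witness-T m d ≈ᵈ to-witness-T m′ d′
to-witness-cong refl = to-witness-≈ᵈ (Pointwise-≈ᵈ-refl)

does⁻ : ∀ {a} {A : Set a} (a? : Dec A) → does a? ≡ true → A
does⁻ (yes a) _ = a

-- Finite subsets: differences, cardinalities and partitions.

p⊆q⇒p∪q─p≡q : ∀ {n} {p q : Subset n} → p ⊆ q → p ∪ (q ─ p) ≡ q
p⊆q⇒p∪q─p≡q {p = p} {q} p⊆q = ⊆-antisym
  (λ x∈ → [ p⊆q , p─q⊆p q p ]′ (x∈p∪q⁻ p (q ─ p) x∈))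
  (λ {x} x∈q → x∈p∪q⁺ (case x x∈q))
  where
  case : ∀ x → x ∈ q → x ∈ p ⊎ x ∈ q ─ p
  case x x∈q with x ∈? p
  ... | yes x∈p = inj₁ x∈p
  ... | no  x∉p = inj₂ (x∈p∧x∉q⇒x∈p─q x∈q x∉p)

x∈p─q⇒x∉q : ∀ {n} {p q : Subset n} {x} → x ∈ p ─ q → ¬ x ∈ q
x∈p─q⇒x∉q {p = _ ∷ _} {_ ∷ _} (there x∈p─q) (there x∈q) = x∈p─q⇒x∉q x∈p─q x∈q
x∈p─q⇒x∉q {p = true ∷ _} {_ ∷ _} () here
x∈p─q⇒x∉q {p = false ∷ _} {_ ∷ _} () here

p⊆q⇒∣p∣+∣q─p∣≡∣q∣ : ∀ {n} {p q : Subset n} → p ⊆ q → ∣ p ∣ ℕ.+ ∣ q ─ p ∣ ≡ ∣ q ∣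
p⊆q⇒∣p∣+∣q─p∣≡∣q∣ {p = []} {[]} _ = refl
p⊆q⇒∣p∣+∣q─p∣≡∣q∣ {p = outside ∷ p} {outside ∷ q} p⊆q =
  p⊆q⇒∣p∣+∣q─p∣≡∣q∣ (drop-∷-⊆ p⊆q)
p⊆q⇒∣p∣+∣q─p∣≡∣q∣ {p = outside ∷ p} {inside ∷ q} p⊆q =
  trans (ℕ.+-suc ∣ p ∣ ∣ q ─ p ∣) (cong ℕ.suc (p⊆q⇒∣p∣+∣q─p∣≡∣q∣ (drop-∷-⊆ p⊆q)))
p⊆q⇒∣p∣+∣q─p∣≡∣q∣ {p = inside ∷ p} {outside ∷ q} p⊆q = contradiction (p⊆q here) λ ()
p⊆q⇒∣p∣+∣q─p∣≡∣q∣ {p = inside ∷ p} {inside ∷ q} p⊆q =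
  cong ℕ.suc (p⊆q⇒∣p∣+∣q─p∣≡∣q∣ (drop-∷-⊆ p⊆q))

x≢y⇒2≤∣p∣ : ∀ {n} {p : Subset n} {x y} → x ∈ p → y ∈ p → x ≢ y → 2 ℕ.≤ ∣ p ∣
x≢y⇒2≤∣p∣ {p = p} {x} {y} x∈p y∈p x≢y =
  subst (ℕ._< ∣ p ∣) (∣⁅x⁆∣≡1 x) (p⊂q⇒∣p∣<∣q∣ {p = ⁅ x ⁆} {p}
    ( (λ z∈⁅x⁆ → subst (_∈ p) (sym (x∈⁅y⁆⇒x≡y x z∈⁅x⁆)) x∈p)
    , y , y∈p , λ y∈⁅x⁆ → x≢y (sym (x∈⁅y⁆⇒x≡y x y∈⁅x⁆))))

Nonempty⇒0<∣p∣ : ∀ {n} {p : Subset n} → .(Nonempty p) → 0 ℕ.< ∣ p ∣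
Nonempty⇒0<∣p∣ {p = p} ne with recompute (nonempty? p) ne
... | x , x∈p = subst (0 ℕ.<_) (p⊆q⇒∣p∣+∣q─p∣≡∣q∣ (λ z∈⁅x⁆ →
    subst (_∈ p) (sym (x∈⁅y⁆⇒x≡y x z∈⁅x⁆)) x∈p))
  (ℕ.≤-trans (ℕ.≤-reflexive (sym (∣⁅x⁆∣≡1 x))) (ℕ.m≤m+n ∣ ⁅ x ⁆ ∣ _))

p⊂q⇒Nonempty-q─p : ∀ {n} {p q : Subset n} → p ⊂ q → Nonempty (q ─ p)
p⊂q⇒Nonempty-q─p (_ , x , x∈q , x∉p) = x , x∈p∧x∉q⇒x∈p─q x∈q x∉p

⊂-partition : ∀ {n} {p q : Subset n} → Nonempty p → p ⊂ q → Partition q p (q ─ p)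
⊂-partition {p = p} {q} p≢∅ p⊂q = record
  { nonemptyˡ = p≢∅
  ; nonemptyʳ = p⊂q⇒Nonempty-q─p p⊂q
  ; disjoint  = λ (x , x∈) → let x∈p , x∈q─p = x∈p∩q⁻ p (q ─ p) x∈
                             in x∈p─q⇒x∉q x∈q─p x∈p
  ; covers    = p⊆q⇒p∪q─p≡q (proj₁ p⊂q) }

-- Values of the game and the quotient compared with those of the members.

module _ {n : ℕ} (M : Family n) (_∼?_ : DecidableClasses M)
         (T : Pred (Family.S M) 0ℓ) (J : Subset n) where
  open Family M
  open Abstraction M _∼?_ J

  private
    module G = Game game

    T₁ : Pred (S ⊎ State₂) 0ℓ
    T₁ = [ T , const ⊥ ]′

  module _ (σ₁ : Policy G.Available₁) (σ₂ : Policy G.Available₂)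
           (c : S → Distr S) where
    private
      -- An arbitrary chain on `S`: `ℙ◇≤game` is later applied to one induced on the quotient,
      -- `game≤ℙ◇` to one induced on a member.
      C : MarkovChain S
      C = record { s₀ = s₀ ; step = c }

      D : MarkovChain (S ⊎ State₂)
      D = G.induced σ₁ σ₂

      move : S → State₂
      move s = (s , choice σ₁ s) {available σ₁ s}

      response : S → S → [0,∞]
      response s t = mass (MarkovChain.step D (inj₂ (move s))) (inj₁ t)

      play : S → List S → List (S ⊎ State₂)
      play s []      = []
      play s (t ∷ π) = inj₂ (move s) ∷ inj₁ t ∷ play t π

      play-injective : ∀ {s} π ρ → play s π ≡ play s ρ → π ≡ ρ
      play-injective []      []      _  = refl
      play-injective (t ∷ π) (u ∷ ρ) eq
        with refl , eq′ ← ∷-injective (∷-injectiveʳ eq) =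
        cong (t ∷_) (play-injective π ρ eq′)

      FirstHit-play : ∀ s π → FirstHit C T s π → FirstHit D T₁ (inj₁ s) (play s π)
      FirstHit-play s []      hit          = hit
      FirstHit-play s (t ∷ π) (¬hit , hit) = ¬hit , (λ ()) , FirstHit-play t π hit

    module _ (c≤response : ∀ s t → mass (c s) t ≤ response s t) where
      private
        pathMass-play : ∀ s π →
          pathMass C T s π ≤ pathMass D T₁ (inj₁ s) (play s π)
        pathMass-play s []      r<1 = r<1
        -- Player 1's Dirac step to `move s` costs no mass; only Player 2's step is compared with
        -- `c`.
        pathMass-play s (t ∷ π) r<x = 𝟙*⁺ (response s t * rest) refl
          (*-mono-≤ {mass (c s) t} {response s t} {pathMass C T t π} {rest}
            (c≤response s t) (pathMass-play t π) r<x)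
          where
          rest : [0,∞]
          rest = pathMass D T₁ (inj₁ t) (play t π)

      ℙ◇≤game : ℙ◇ C T ≤ ℙ◇ D T₁
      ℙ◇≤game = ∑-transfer (λ π ρ → play s₀ π ≡ ρ)
        (λ { {π} {π′} eq eq′ → play-injective π π′ (trans eq (sym eq′)) })
        λ {π} hit r<π →
          inj₂ (play s₀ π , FirstHit-play s₀ π hit , refl , pathMass-play s₀ π r<π)

    module _ (response≤c : ∀ s t → response s t ≤ mass (c s) t) where
      private
        -- A path reaching the target either has the form `play s ρ` or contains a step of mass 0,
        -- which leaves only negative r.
        unplay : ∀ s π {r} → FirstHit D T₁ (inj₁ s) π →
          Below (pathMass D T₁ (inj₁ s) π) r →
          r ℚ.< 0ℚ ⊎
          ∃[ ρ ] FirstHit C T s ρ × π ≡ play s ρ × Below (pathMass C T s ρ) r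
        unplay s [] hit r<1 = inj₂ ([] , hit , refl , r<1)
        -- Player 1's Dirac step cannot end in a Player 1 state.
        unplay s (inj₁ t ∷ π) _ r<π
          with 𝟙*⁻ (pathMass D T₁ (inj₁ t) π) r<π
        ... | inj₁ r<0 = inj₁ r<0
        -- `embed` gives mass 0 to Player 2 states.
        unplay s (inj₂ v ∷ inj₂ w ∷ π) _ r<π
          with 𝟙*⁻ (pathMass D T₁ (inj₂ v) (inj₂ w ∷ π)) r<π
        ... | inj₁ r<0       = inj₁ r<0
        ... | inj₂ (_ , r<π′) = inj₁ (0∞*⁻ (pathMass D T₁ (inj₂ w) π) r<π′)
        unplay s (inj₂ v ∷ inj₁ t ∷ π) (¬hit , _ , hit) r<π
          with 𝟙*⁻ (pathMass D T₁ (inj₂ v) (inj₁ t ∷ π)) r<π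
        ... | inj₁ r<0 = inj₁ r<0
        -- Here `refl` identifies v with `move s`.
        ... | inj₂ (refl , inj₁ r<0) = inj₁ r<0
        ... | inj₂ (refl , inj₂ (p , q , 0≤p , 0≤q , p<x , q<y , r<pq))
          with unplay t π hit q<y
        ... | inj₁ q<0 = contradiction (ℚ.≤-<-trans 0≤q q<0) (ℚ.<-irrefl refl)
        ... | inj₂ (ρ , hitρ , refl , q<ρ) = inj₂
          ( t ∷ ρ , (¬hit , hitρ) , refl
          , inj₂ (p , q , 0≤p , 0≤q , response≤c s t p<x , q<ρ , r<pq))

      game≤ℙ◇ : ℙ◇ D T₁ ≤ ℙ◇ C T
      game≤ℙ◇ = ∑-transfer (λ π ρ → π ≡ play s₀ ρ) (λ { refl refl → refl })
        (λ {π} → unplay s₀ π)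

  guaranteed≤ℙ◇ : ∀ {i} → i ∈ J → (σ : Policy Available) →
    G.guaranteed T σ ≤ ℙ◇ (MDP.induced (member i) (restrict σ i)) T
  guaranteed≤ℙ◇ {i} i∈J σ (r′ , r<r′ , r′<) = lower (ℙ◇ M′ T) r<r′
    (game≤ℙ◇ σ σ₂ (MarkovChain.step M′)
      (λ s t → proj₁ (to-witness-cong {m = P i s (choice σ s)} refl _ _ t)) (r′< σ₂))
    where
    M′ : MarkovChain S
    M′ = MDP.induced (member i) (restrict σ i)
    -- The availability proof names `i` itself as representative, so the game draws exactly from
    -- `P i`.
    σ₂ : Policy G.Available₂
    σ₂ = record { choice    = λ v → class (State₂.state v) (State₂.action v) i
                ; available = λ v → i , i∈J , refl }

  ∈class⁻ : ∀ {s α i j} → j ∈ class s α i → i ∼[ s , α ] j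
  ∈class⁻ {s} {α} {i} {j} j∈ = proj₂ (does⁻ ((j ∈? J) ×-dec (s ∼? α) i j)
    (trans (sym (lookup∘tabulate _ j)) ([]=⇒lookup j∈)))

  i∈class-i : ∀ {s α i} → i ∈ J → i ∈ class s α i
  i∈class-i {s} {α} {i} i∈J = lookup⇒[]= i _ (trans (lookup∘tabulate _ i)
    (dec-true ((i ∈? J) ×-dec (s ∼? α) i i) (i∈J , Pointwise-≈ᵈ-refl)))

  -- `isClass?` may find another representative j. Then `i` lies in the class of j, so the two
  -- distributions agree up to `≈ᵈ`.
  quotientP-class : ∀ {s α i} → i ∈ J →
    Pointwise _≈ᵈ_ (P i s α) (quotientP s (α , class s α i))
  quotientP-class {s} {α} {i} i∈J with isClass? s α (class s α i)
  ... | yes (j , j∈J , class-i≡class-j) =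
    Pointwise.sym (λ μ≈ν t → swap (μ≈ν t))
      (∈class⁻ (subst (i ∈_) class-i≡class-j (i∈class-i i∈J)))
  ... | no ¬class = contradiction (i , i∈J , refl) ¬class

  ℙ◇≤ℙmax-quotient : ∀ {i} .(ne : Nonempty J) → i ∈ J →
    (σ : Policy (MDP.Available (member i))) →
    ℙ◇ (MDP.induced (member i) σ) T ≤ MDP.ℙmax (quotient ne) T
  ℙ◇≤ℙmax-quotient {i} ne i∈J σ r<x = inj₂ (σ′ ,
    ℙ◇-mono T (λ s t → proj₁ (to-witness-≈ᵈ (quotientP-class i∈J)
      (available σ s) (available σ′ s) t)) r<x)
    where
    σ′ : Policy (MDP.Available (quotient ne))
    σ′ = record
      { choice    = λ s → choice σ s , class s (choice σ s) i
      ; available = λ s → Defined-resp (quotientP-class i∈J) (available σ s) }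

  quotientP⁻ : ∀ s α I → Defined (quotientP s (α , I)) →
    ∃[ i ] i ∈ J × quotientP s (α , I) ≡ P i s α
  quotientP⁻ s α I d with isClass? s α I
  ... | yes (i , i∈J , _) = i , i∈J , refl

  -- On a singleton Player 2 has no choice, so game and quotient agree.
  ℙmax-quotient≤ℙmax-game : .(ne : Nonempty J) → (∀ {i j} → i ∈ J → j ∈ J → i ≡ j) →
    MDP.ℙmax (quotient ne) T ≤ G.ℙmax T
  ℙmax-quotient≤ℙmax-game ne unique (inj₁ r<0) = inj₁ r<0
  ℙmax-quotient≤ℙmax-game ne unique (inj₂ (σ , r<x)) =
    -- The infimum asks for a single r′ > r that serves every `σ₂`, so r′ is fixed before `σ₂` is
    -- given.
    let r′ , r<r′ , r′<x = rounded (ℙ◇ (MDP.induced (quotient ne) σ) T) r<x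
    in inj₂ (σ₁ , r′ , r<r′ , λ σ₂ →
         ℙ◇≤game σ₁ σ₂ (MarkovChain.step (MDP.induced (quotient ne) σ))
           (λ s t → proj₁ (to-witness-cong (eq σ₂ s) _ _ t)) r′<x)
    where
    chosen : ∀ s → ∃[ i ] i ∈ J × quotientP s (choice σ s) ≡ P i s (proj₁ (choice σ s))
    chosen s = quotientP⁻ s _ _ (available σ s)
    σ₁ : Policy Available
    σ₁ = record
      { choice    = proj₁ ∘ choice σ
      ; available = λ s j → let i , _ , eq = chosen s
                            in shared s _ i j (subst Defined eq (available σ s)) }
    eq : ∀ (σ₂ : Policy G.Available₂) s →
      let α = proj₁ (choice σ s) in
      quotientP s (choice σ s) ≡
      P (proj₁ (available σ₂ ((s , α) {available σ₁ s}))) s α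
    eq σ₂ s =
      -- The representative found by `isClass?` and the one named by `σ₂` both lie in `J`, hence
      -- coincide.
      let i , i∈J , eq = chosen s
          _ , j∈J , _ = available σ₂ ((s , proj₁ (choice σ s)) {available σ₁ s})
      in trans eq (cong (λ i → P i s (proj₁ (choice σ s))) (unique i∈J j∈J))

-- Termination, soundness and number of splits of `BuildTree`.

module _ {n : ℕ} (M : Family n) (_∼?_ : DecidableClasses M)
         (T : Pred (Family.S M) 0ℓ) (threshold : [0,∞])
         (sub : Subroutines M _∼?_ T threshold) where
  open Family M
  open Subroutines sub
  private
    module A = Abstraction M _∼?_
    module G (J : Subset n) = Game (A.game J)
    module Q (J : Subset n) .(ne : Nonempty J) = MDP (A.quotient J ne)

    Build : Subset n → Tree n (Policy Available) → ℕ → Set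
    Build = BuildTree M _∼?_ T threshold sub

  -- Supplies the size premise of `createSplit-nontrivial` whenever both leaf tests fail.
  2≤∣J∣ : ∀ {J} .(ne : Nonempty J) → ¬ (threshold ≤ G.ℙmax J T) →
          ¬ (Q.ℙmax J ne T < threshold) → 2 ℕ.≤ ∣ J ∣
  2≤∣J∣ {J} ne ¬robust ¬unsat with 2 ℕ.≤? ∣ J ∣
  ... | yes 2≤ = 2≤
  -- `¬unsat` is only the double negation of `threshold ≤ Q.ℙmax J ne T`, which suffices for a
  -- contradiction.
  ... | no 2≰ = contradiction
    (λ threshold≤Q → ¬robust λ r< →
      ℙmax-quotient≤ℙmax-game M _∼?_ T J ne unique (threshold≤Q r<))
    ¬unsat
    where
    unique : ∀ {i j} → i ∈ J → j ∈ J → i ≡ j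
    unique {i} {j} i∈J j∈J with i Fin.≟ j
    ... | yes i≡j = i≡j
    ... | no i≢j = contradiction (x≢y⇒2≤∣p∣ i∈J j∈J i≢j) 2≰

  terminates : ∀ J → Acc ℕ._<_ ∣ J ∣ → Nonempty J → ∃₂ (Build J)
  terminates J (acc rec) ne with robust? J ne
  ... | yes rob = _ , _ , robust ne rob
  ... | no ¬rob with unsat? J ne
  ...   | yes uns = _ , _ , unsat ne ¬rob uns
  ...   | no ¬uns =
    let (i , i∈J′) , J′⊂J = createSplit-nontrivial J ne (2≤∣J∣ ne ¬rob ¬uns)
        J′ = createSplit J ne (findRobust J ne)
        _ , _ , l = terminates J′ (rec (p⊂q⇒∣p∣<∣q∣ J′⊂J)) (i , i∈J′)
        _ , _ , r = terminates (J ─ J′)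
          -- The complement is smaller because `J′` meets `J`.
          (rec (p∩q≢∅⇒∣p─q∣<∣p∣ J J′ (i , x∈p∩q⁺ (proj₁ J′⊂J i∈J′ , i∈J′))))
          (p⊂q⇒Nonempty-q─p J′⊂J)
    in _ , _ , split ne ¬rob ¬uns l r

  subfamily-Build : ∀ {J t k} → Build J t k → subfamily t ≡ J
  subfamily-Build (robust _ _)      = refl
  subfamily-Build (unsat _ _ _)     = refl
  subfamily-Build (split _ _ _ _ _) = refl

  sound : ∀ {J t k} → Build J t k → Satisficing M T threshold t
  sound {J} (robust ne rob) = robust λ i i∈J r< →
    guaranteed≤ℙ◇ M _∼?_ T J i∈J (proj₁ (findRobust J ne))
      -- Optimality turns a bound on the supremum into one on what this single policy guarantees.
      (proj₂ (findRobust-optimal J ne) (rob r<))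
  sound {J} (unsat ne _ uns) = unsat λ i i∈J (σ , wins) →
    uns λ r< → ℙ◇≤ℙmax-quotient M _∼?_ T J ne i∈J σ (wins r<)
  sound {J} (split ne ¬rob ¬uns l r) =
    let J′≢∅ , J′⊂J = createSplit-nontrivial J ne (2≤∣J∣ ne ¬rob ¬uns)
    in inner (subst₂ (Partition J) (sym (subfamily-Build l)) (sym (subfamily-Build r))
               (⊂-partition J′≢∅ J′⊂J))
         (sound l) (sound r)

  -- Strictness carries the induction: each of the two subtrees saves one split, and one of these
  -- pays for the split at their parent.
  splits<∣J∣ : ∀ {J t k} → Build J t k → k ℕ.< ∣ J ∣
  splits<∣J∣ {J} (robust ne _)  = Nonempty⇒0<∣p∣ ne
  splits<∣J∣ {J} (unsat ne _ _) = Nonempty⇒0<∣p∣ ne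
  splits<∣J∣ {J} (split {k = k} {m} ne ¬rob ¬uns l r) =
    let J′⊂J = proj₂ (createSplit-nontrivial J ne (2≤∣J∣ ne ¬rob ¬uns))
    in subst₂ ℕ._≤_ (cong ℕ.suc (ℕ.+-suc k m)) (p⊆q⇒∣p∣+∣q─p∣≡∣q∣ (proj₁ J′⊂J))
         (ℕ.+-mono-≤ (splits<∣J∣ l) (splits<∣J∣ r))

theorem2 : (n : ℕ) → 1 ℕ.≤ n →
    (M : Family n) (_∼?_ : DecidableClasses M)
    (T : Pred (Family.S M) 0ℓ) (threshold : [0,∞]) → threshold ≤ 1∞ →
    (sub : Subroutines M _∼?_ T threshold) →
    (∃₂ λ t k → BuildTree M _∼?_ T threshold sub ⊤ t k) ×
    (∀ t k → BuildTree M _∼?_ T threshold sub ⊤ t k →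
    IsPolicyTree M T threshold t × k ℕ.≤ n)
theorem2 n@(ℕ.suc _) 1≤n M _∼?_ T threshold _ sub =
  terminates M _∼?_ T threshold sub ⊤ (<-wellFounded _) (zero , ∈⊤) ,
  λ t k b →
    ( subfamily-Build M _∼?_ T threshold sub b
    , sound M _∼?_ T threshold sub b)
    , subst (k ℕ.≤_) (∣⊤∣≡n n) (ℕ.<⇒≤ (splits<∣J∣ M _∼?_ T threshold sub b))
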